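{- There is a constant $C \geq 0$ for which the following holds for all integers $n \ge 1$ and $k \ge 0$. If $\alpha, \beta \in S_n$ satisfy $d_U(\alpha,\beta) = k$, then \[ \Big|\{\gamma \in S_n : d_U(\alpha,\gamma) \leq k \text{ and } d_U(\beta,\gamma) \leq k\}\Big| \leq 2^{k + C k^{2/3}} \frac{n!}{(n-k)!}. \]
   Context: Let $S_n$ denote the set of permutations of $\{1,\ldots,n\}$, written in one-line notation as strings $\sigma(1)\sigma(2)\cdots\sigma(n)$. For $\sigma \in S_n$ and $A \subseteq \{1,\ldots,n\}$, $\sigma - A$ denotes the string obtained from $\sigma$ by deleting all symbols in $A$ (and contracting). The Ulam distance is $d_U(\alpha,\beta) = \min\{|A| : \alpha - A = \beta - A\}$ for $\alpha,\beta \in S_n$. -}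

module Defs where

open import Data.Nat using (ℕ; _≤_)
open import Data.Fin using (Fin)
open import Data.Fin.Subset using (Subset; ∣_∣)
open import Data.Vec using (lookup)
open import Data.Bool using (true; false)
open import Data.List using (List; []; _∷_; length)
open import Data.List.Relation.Unary.Unique.Propositional using (Unique)
open import Data.List.Relation.Unary.All using (All)
open import Data.Product using (_×_; ∃; ∃-syntax; _,_)
open import Relation.Binary.PropositionalEquality using (_≡_)

-- A permutation of {1,…,n} in one-line notation: a duplicate-free list of
-- length n over the symbols Fin n (symbol i+1 is represented by i).
IsPerm : {n : ℕ} → List (Fin n) → Set
IsPerm {n} σ = length σ ≡ n × Unique σ

delete : {n : ℕ} → Subset n → List (Fin n) → List (Fin n)
delete A [] = []
delete A (x ∷ σ) with lookup A x
... | true  = delete A σ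
... | false = x ∷ delete A σ

UlamDist : {n : ℕ} → List (Fin n) → List (Fin n) → ℕ → Set
UlamDist {n} α β k =
  (∃[ A ] (∣ A ∣ ≡ k × delete A α ≡ delete A β))
  × ((A : Subset n) → delete A α ≡ delete A β → k ≤ ∣ A ∣)

UlamDist≤ : {n : ℕ} → List (Fin n) → List (Fin n) → ℕ → Set
UlamDist≤ α γ k = ∃[ j ] (UlamDist α γ j × j ≤ k)

InBall2 : {n : ℕ} → List (Fin n) → List (Fin n) → ℕ → List (Fin n) → Set
InBall2 α β k γ = IsPerm γ × UlamDist≤ α γ k × UlamDist≤ β γ k

{-# OPTIONS --safe #-}
module Submission where

-- Let γ be obtained from α by moving a set A of k symbols and from β by moving
-- a set B of k symbols, and let t = |A \ B| = |B \ A|. Deleting A ∪ B leaves a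
-- common string of α and β, so there are at most 2^(k+t) C(n−k, t) choices of
-- A ∪ B: reading α and β from the left, a mismatch forces one of two symbols to
-- be deleted, a match leaves the choice of keeping or deleting, and no common
-- subsequence is longer than n − k. Then there are at most 4^t C(k+t, 2t)
-- choices of A and B within the union, at most 4^t ways of merging α − A with
-- β − B into γ − (A ∩ B), and at most n!/(n−k+t)! ways of inserting A ∩ B. The
-- product is at most 2^k (128 k²)^t / (t!)³ · n!/(n−k)!, where
-- (128 k²)^t / (t!)³ ≤ (p^t / t!)³ ≤ 64^p as soon as p³ ≥ 128 k².

open import Defs
open import Data.Nat using (ℕ; _≤_; _*_; _+_; _∸_; _^_; _!)
open import Data.Fin using (Fin)
open import Data.List using (List; length)
open import Data.List.Relation.Unary.Unique.Propositional using (Unique)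
open import Data.List.Relation.Unary.All using (All)
open import Data.Product using (_×_; ∃; ∃-syntax)

open import Data.Bool using (Bool; true; false; not; _∧_; _∨_; T?)
open import Data.Bool.Properties using (T-≡; ∧-comm; ∧-idem; not-injective; not-involutive)
open import Data.Fin using (zero; suc)
open import Data.Fin.Properties using (_≟_)
open import Data.Fin.Subset using (Subset; ∣_∣)
open import Data.Fin.Subset.Properties using (∣p∣≤n)
open import Data.List using ([]; _∷_; _++_; map; concatMap; filterᵇ; upTo; take; drop; allFin; tabulate)
open import Data.List.Properties using (length-++; length-map; length-upTo; length-tabulate; ++-identityʳ; filter-++; ∷-injectiveˡ; ∷-injectiveʳ)
open import Data.List.Membership.Propositional using (_∈_; _∉_)
open import Data.List.Membership.Propositional.Properties using (∈-filter⁺; ∈-filter⁻; ∈-∃++; ∈-map⁺; ∈-++⁺ˡ; ∈-++⁺ʳ; ∈-concatMap⁺; ∈-upTo⁺; ∈-upTo⁻; ∈-allFin)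
open import Data.List.Relation.Binary.Permutation.Propositional using (_↭_; ↭-refl; ↭-reflexive; ↭-sym; ↭-trans; ↭-prep; ↭⇒↭ₛ)
open import Data.List.Relation.Binary.Permutation.Propositional.Properties using (∈-resp-↭; drop-∷; ↭-length; shift; filter-↭; ¬x∷xs↭[])
import Data.List.Relation.Binary.Permutation.Setoid.Properties as ↭ₛ
open import Data.List.Relation.Binary.Sublist.Propositional as Sublist using (_⊆_; []; _∷_; _∷ʳ_; minimum; ⊆-refl; ⊆-trans)
open import Data.List.Relation.Binary.Sublist.Propositional.Properties using (filter-⊆)
import Data.List.Relation.Unary.All as All
open import Data.List.Relation.Unary.AllPairs using (_∷_)
import Data.List.Relation.Unary.Any as Any
open import Data.List.Relation.Unary.Any using (here; there)
import Data.List.Relation.Unary.Unique.Propositional.Properties as Unique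
open import Data.Nat using (zero; suc; _⊓_; _<_; z≤n; s≤s; z<s)
open import Data.Nat.Combinatorics using (nCk+nC[k+1]≡[n+1]C[k+1]; nCk≡n!/k![n-k]!; k![n∸k]!∣n!; nCn≡1) renaming (_C_ to _choose_)
open import Data.Nat.DivMod using (m/n*n≡m)
open import Data.Nat.Properties hiding (_≟_)
open import Data.Nat.Tactic.RingSolver using (solve-∀)
open import Data.Product using (_,_; proj₁; proj₂)
open import Data.Unit using (tt)
import Data.Vec as Vec
open import Data.Vec using ([]; _∷_; lookup)
open import Data.Vec.Properties using (lookup∘tabulate)
open import Function using (_∘_; Equivalence)
open import Relation.Binary.Definitions using (DecidableEquality)
open import Relation.Binary.PropositionalEquality
open import Relation.Nullary using (does; yes; no; contradiction)
open import Relation.Nullary.Decidable using (dec-true; dec-false)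

private variable
  A B : Set
  x : A
  xs ys : List A

-- Factorials and powers

^-distribʳ-* : ∀ t m n → (m * n) ^ t ≡ m ^ t * n ^ t
^-distribʳ-* zero m n = refl
^-distribʳ-* (suc t) m n = begin
  m * n * (m * n) ^ t         ≡⟨ cong (m * n *_) (^-distribʳ-* t m n) ⟩
  m * n * (m ^ t * n ^ t)     ≡⟨ [m*n]*[o*p]≡[m*o]*[n*p] m n (m ^ t) (n ^ t) ⟩
  m ^ suc t * n ^ suc t       ∎
  where open ≡-Reasoning

C-factorial : ∀ a b → ((a + b) choose a) * (a ! * b !) ≡ (a + b) !
C-factorial a b = trans (cong (λ c → ((a + b) choose a) * (a ! * c !)) (sym (m+n∸m≡n a b)))
  (trans (cong (_* (a ! * (a + b ∸ a) !)) (nCk≡n!/k![n-k]! (m≤m+n a b)))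
    (m/n*n≡m {{a !* (a + b ∸ a) !≢0}} (k![n∸k]!∣n! (m≤m+n a b))))

C≤2^ : ∀ n k → n choose k ≤ 2 ^ n
C≤2^ zero zero = ≤-refl
C≤2^ zero (suc k) = z≤n
C≤2^ (suc n) zero = m^n>0 2 (suc n)
C≤2^ (suc n) (suc k) = begin
  suc n choose suc k    ≡⟨ nCk+nC[k+1]≡[n+1]C[k+1] n k ⟨
  n choose k + n choose suc k ≤⟨ +-mono-≤ (C≤2^ n k) (C≤2^ n (suc k)) ⟩
  2 ^ n + 2 ^ n         ≡⟨ cong (2 ^ n +_) (+-identityʳ (2 ^ n)) ⟨
  2 ^ suc n             ∎
  where open ≤-Reasoning

-- The quotient (x + t)!/x! is a product of t factors that grow with x; the inequality is this
-- monotonicity, cross-multiplied.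
!-+-mono : ∀ {a b} t → a ≤ b → (a + t) ! * b ! ≤ a ! * (b + t) !
!-+-mono {a} {b} zero a≤b = ≤-reflexive (cong₂ (λ x y → x ! * y !) (+-identityʳ a) (sym (+-identityʳ b)))
!-+-mono {a} {b} (suc t) a≤b = begin
  (a + suc t) ! * b !              ≡⟨ cong (λ x → x ! * b !) (+-suc a t) ⟩
  suc (a + t) * (a + t) ! * b !    ≡⟨ *-assoc (suc (a + t)) ((a + t) !) (b !) ⟩
  suc (a + t) * ((a + t) ! * b !)  ≤⟨ *-mono-≤ (s≤s (+-monoˡ-≤ t a≤b)) (!-+-mono t a≤b) ⟩
  suc (b + t) * (a ! * (b + t) !)  ≡⟨ lemma (suc (b + t)) (a !) ((b + t) !) ⟩
  a ! * suc (b + t) !              ≡⟨ cong (λ x → a ! * x !) (+-suc b t) ⟨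
  a ! * (b + suc t) !              ∎
  where
  open ≤-Reasoning
  lemma : ∀ x y z → x * (y * z) ≡ y * (x * z)
  lemma = solve-∀

-- (a + b)!/a! is a product of b factors, each at most a + b.
[a+b]!≤a!*[a+b]^b : ∀ a b → (a + b) ! ≤ a ! * (a + b) ^ b
[a+b]!≤a!*[a+b]^b a zero = ≤-reflexive (trans (cong _! (+-identityʳ a)) (sym (*-identityʳ (a !))))
[a+b]!≤a!*[a+b]^b a (suc b) = begin
  (a + suc b) !                         ≡⟨ cong _! (+-suc a b) ⟩
  suc (a + b) * (a + b) !               ≤⟨ *-monoʳ-≤ (suc (a + b)) ([a+b]!≤a!*[a+b]^b a b) ⟩
  suc (a + b) * (a ! * (a + b) ^ b)     ≤⟨ *-monoʳ-≤ (suc (a + b)) (*-monoʳ-≤ (a !) (^-monoˡ-≤ b (n≤1+n (a + b)))) ⟩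
  suc (a + b) * (a ! * suc (a + b) ^ b) ≡⟨ lemma (suc (a + b)) (a !) (suc (a + b) ^ b) ⟩
  a ! * suc (a + b) ^ suc b             ≡⟨ cong (λ x → a ! * x ^ suc b) (+-suc a b) ⟨
  a ! * (a + suc b) ^ suc b             ∎
  where
  open ≤-Reasoning
  lemma : ∀ x y z → x * (y * z) ≡ y * (x * z)
  lemma = solve-∀

a^b*a!≤[a+b]! : ∀ a b → a ^ b * a ! ≤ (a + b) !
a^b*a!≤[a+b]! a zero = ≤-reflexive (trans (*-identityˡ (a !)) (cong _! (sym (+-identityʳ a))))
a^b*a!≤[a+b]! a (suc b) = begin
  a * a ^ b * a !           ≡⟨ *-assoc a (a ^ b) (a !) ⟩
  a * (a ^ b * a !)         ≤⟨ *-mono-≤ (m≤n⇒m≤1+n (m≤m+n a b)) (a^b*a!≤[a+b]! a b) ⟩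
  suc (a + b) * (a + b) !   ≡⟨ cong _! (+-suc a b) ⟨
  (a + suc b) !             ∎
  where open ≤-Reasoning

-- C(r + t, r) t! equals (r + t)!/r!, a product of t factors, and these are dominated by the t
-- factors of (r + 2t)!/(r + t)!.
C*t!*[r+t]!≤[r+t+t]! : ∀ r t → ((r + t) choose r) * t ! * (r + t) ! ≤ (r + t + t) !
C*t!*[r+t]!≤[r+t+t]! r t = *-cancelˡ-≤ (r !) {{r !≢0}} (begin
  r ! * (((r + t) choose r) * t ! * (r + t) !) ≡⟨ lemma (r !) ((r + t) choose r) (t !) ((r + t) !) ⟩
  ((r + t) choose r) * (r ! * t !) * (r + t) ! ≡⟨ cong (_* (r + t) !) (C-factorial r t) ⟩
  (r + t) ! * (r + t) !                     ≤⟨ !-+-mono t (m≤m+n r t) ⟩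
  r ! * (r + t + t) !                       ∎)
  where
  open ≤-Reasoning
  lemma : ∀ x y z w → x * (y * z * w) ≡ y * (x * z) * w
  lemma = solve-∀

C*b!≤[a+b]^b : ∀ a b → ((a + b) choose b) * b ! ≤ (a + b) ^ b
C*b!≤[a+b]^b a b = *-cancelˡ-≤ (a !) {{a !≢0}} (begin
  a ! * (((a + b) choose b) * b !) ≡⟨ lemma (a !) ((a + b) choose b) (b !) ⟩
  ((a + b) choose b) * (b ! * a !) ≡⟨ cong (λ x → (x choose b) * (b ! * a !)) (+-comm a b) ⟩
  ((b + a) choose b) * (b ! * a !) ≡⟨ C-factorial b a ⟩
  (b + a) !                     ≡⟨ cong _! (+-comm b a) ⟩
  (a + b) !                     ≤⟨ [a+b]!≤a!*[a+b]^b a b ⟩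
  a ! * (a + b) ^ b             ∎)
  where
  open ≤-Reasoning
  lemma : ∀ x y z → x * (y * z) ≡ y * (z * x)
  lemma = solve-∀

t!*t!≤[t+t]! : ∀ t → t ! * t ! ≤ (t + t) !
t!*t!≤[t+t]! t = ≤-trans (!-+-mono {0} {t} t z≤n) (≤-reflexive (*-identityˡ _))

-- An integer substitute for p^t/t! ≤ e^p: (2p)^t/t! is at most C(2p + t, 2p) ≤ 2^(2p + t), and the
-- 2^t gained by doubling p cancels.
p^t≤4^p*t! : ∀ p t → p ^ t ≤ 4 ^ p * t !
p^t≤4^p*t! p t = *-cancelˡ-≤ (2 ^ t * q !) {{m*n≢0 (2 ^ t) (q !) {{m^n≢0 2 t}} {{q !≢0}}}} (begin
  2 ^ t * q ! * p ^ t               ≡⟨ lemma₁ (2 ^ t) (q !) (p ^ t) ⟩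
  2 ^ t * p ^ t * q !               ≡⟨ cong (_* q !) (^-distribʳ-* t 2 p) ⟨
  q ^ t * q !                       ≤⟨ a^b*a!≤[a+b]! q t ⟩
  (q + t) !                         ≡⟨ C-factorial q t ⟨
  ((q + t) choose q) * (q ! * t !)  ≤⟨ *-monoˡ-≤ (q ! * t !) (C≤2^ (q + t) q) ⟩
  2 ^ (q + t) * (q ! * t !)         ≡⟨ cong (_* (q ! * t !)) (^-distribˡ-+-* 2 q t) ⟩
  2 ^ q * 2 ^ t * (q ! * t !)       ≡⟨ cong (λ x → x * 2 ^ t * (q ! * t !)) (^-*-assoc 2 2 p) ⟨
  4 ^ p * 2 ^ t * (q ! * t !)       ≡⟨ lemma₂ (4 ^ p) (2 ^ t) (q !) (t !) ⟩
  2 ^ t * q ! * (4 ^ p * t !)       ∎)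
  where
  open ≤-Reasoning
  q = 2 * p
  lemma₁ : ∀ x y z → x * y * z ≡ x * z * y
  lemma₁ = solve-∀
  lemma₂ : ∀ x y z w → x * y * (z * w) ≡ y * z * (x * w)
  lemma₂ = solve-∀

-- With k = d + t and n − k = r + t: C(n−k, r) (t!) (n−k)! ≤ (n−k+t)! and
-- C(k+t, 2t) (t!)² ≤ (2k)^(2t), so everything is multiplied by (t!)³.
level-bound : ∀ r t d p → 128 * ((d + t) * (d + t)) ≤ p ^ 3 →
  2 ^ (d + t + t) * ((r + t) choose r) * (2 ^ (t + t) * ((d + (t + t)) choose (t + t)) * 2 ^ (t + t)) * (r + t) !
    ≤ 2 ^ (d + t) * 64 ^ p * (r + t + t) !
level-bound r t d p p≥ = *-cancelˡ-≤ (t ! * (t ! * t !)) {{m*n≢0 (t !) _ {{t !≢0}} {{t !* t !≢0}}}} (begin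
  T * (T * T) * (2 ^ (k + t) * c₁ * (2 ^ (t + t) * c₂ * 2 ^ (t + t)) * N!)
    ≡⟨ cong₂ (λ x y → T * (T * T) * (x * c₁ * (y * c₂ * y) * N!)) (^-distribˡ-+-* 2 k t) (^-distribˡ-+-* 2 t t) ⟩
  T * (T * T) * (K * τ * c₁ * (τ * τ * c₂ * (τ * τ)) * N!)
    ≡⟨ lemma₁ T K τ c₁ c₂ N! ⟩
  K * (τ * (τ * (τ * (τ * τ)))) * (c₁ * T * N!) * (c₂ * (T * T))
    ≤⟨ *-mono-≤ (*-monoʳ-≤ (K * (τ * (τ * (τ * (τ * τ))))) (C*t!*[r+t]!≤[r+t+t]! r t)) c₂-bound ⟩
  K * (τ * (τ * (τ * (τ * τ)))) * (r + t + t) ! * (4 * (k * k)) ^ t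
    ≡⟨ lemma₂ K (τ * (τ * (τ * (τ * τ)))) ((r + t + t) !) ((4 * (k * k)) ^ t) ⟩
  K * (r + t + t) ! * (τ * (τ * (τ * (τ * τ))) * (4 * (k * k)) ^ t)
    ≡⟨ cong (K * (r + t + t) ! *_) powers ⟩
  K * (r + t + t) ! * (128 * (k * k)) ^ t
    ≤⟨ *-monoʳ-≤ (K * (r + t + t) !) (≤-trans (^-monoˡ-≤ t p≥) cubes) ⟩
  K * (r + t + t) ! * (64 ^ p * (T * (T * T)))
    ≡⟨ lemma₃ K ((r + t + t) !) (64 ^ p) (T * (T * T)) ⟩
  T * (T * T) * (K * 64 ^ p * (r + t + t) !) ∎)
  where
  open ≤-Reasoning
  k = d + t
  K = 2 ^ k
  T = t !
  τ = 2 ^ t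
  N! = (r + t) !
  c₁ = (r + t) choose r
  c₂ = (d + (t + t)) choose (t + t)
  lemma₁ : ∀ T K τ c₁ c₂ N! → T * (T * T) * (K * τ * c₁ * (τ * τ * c₂ * (τ * τ)) * N!) ≡
    K * (τ * (τ * (τ * (τ * τ)))) * (c₁ * T * N!) * (c₂ * (T * T))
  lemma₁ = solve-∀
  lemma₂ : ∀ x y z w → x * y * z * w ≡ x * z * (y * w)
  lemma₂ = solve-∀
  lemma₃ : ∀ x y z w → x * y * (z * w) ≡ w * (x * z * y)
  lemma₃ = solve-∀
  k+t≤2k : d + (t + t) ≤ 2 * k
  k+t≤2k = ≤-trans (≤-reflexive (sym (+-assoc d t t)))
    (+-monoʳ-≤ k (≤-trans (m≤n+m t d) (≤-reflexive (sym (+-identityʳ k)))))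
  square : ∀ x → 2 * x * (2 * x) ≡ 4 * (x * x)
  square = solve-∀
  c₂-bound : c₂ * (T * T) ≤ (4 * (k * k)) ^ t
  c₂-bound = begin
    c₂ * (T * T)               ≤⟨ *-monoʳ-≤ c₂ (t!*t!≤[t+t]! t) ⟩
    c₂ * (t + t) !             ≤⟨ C*b!≤[a+b]^b d (t + t) ⟩
    (d + (t + t)) ^ (t + t)    ≤⟨ ^-monoˡ-≤ (t + t) k+t≤2k ⟩
    (2 * k) ^ (t + t)          ≡⟨ ^-distribˡ-+-* (2 * k) t t ⟩
    (2 * k) ^ t * (2 * k) ^ t  ≡⟨ ^-distribʳ-* t (2 * k) (2 * k) ⟨
    (2 * k * (2 * k)) ^ t      ≡⟨ cong (_^ t) (square k) ⟩
    (4 * (k * k)) ^ t          ∎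
  -- Five factors 2^t are left beside 2^k: one from the choice of the union, two from its splitting
  -- and two from the merging. Hence 32^t, and 32 · 4 = 128.
  powers : τ * (τ * (τ * (τ * τ))) * (4 * (k * k)) ^ t ≡ (128 * (k * k)) ^ t
  powers = trans (cong (_* (4 * (k * k)) ^ t) (sym
    (trans (^-distribʳ-* t 2 16) (cong (τ *_) (trans (^-distribʳ-* t 2 8) (cong (τ *_)
    (trans (^-distribʳ-* t 2 4) (cong (τ *_) (^-distribʳ-* t 2 2)))))))))
    (trans (sym (^-distribʳ-* t 32 (4 * (k * k)))) (cong (_^ t) (sym (*-assoc 32 4 (k * k)))))
  cube : ∀ x y → x * y * (x * y * (x * y)) ≡ x * (x * x) * (y * (y * y))
  cube = solve-∀
  cubes : (p ^ 3) ^ t ≤ 64 ^ p * (T * (T * T))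
  cubes = begin
    (p ^ 3) ^ t                ≡⟨ cong (λ x → (p * (p * x)) ^ t) (*-identityʳ p) ⟩
    (p * (p * p)) ^ t          ≡⟨ trans (^-distribʳ-* t p (p * p)) (cong (p ^ t *_) (^-distribʳ-* t p p)) ⟩
    p ^ t * (p ^ t * p ^ t)    ≤⟨ *-mono-≤ (p^t≤4^p*t! p t) (*-mono-≤ (p^t≤4^p*t! p t) (p^t≤4^p*t! p t)) ⟩
    4 ^ p * T * (4 ^ p * T * (4 ^ p * T)) ≡⟨ cube (4 ^ p) T ⟩
    4 ^ p * (4 ^ p * 4 ^ p) * (T * (T * T)) ≡⟨ cong (_* (T * (T * T))) (trans (^-distribʳ-* p 4 16) (cong (4 ^ p *_) (^-distribʳ-* p 4 4))) ⟨
    64 ^ p * (T * (T * T))     ∎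

-- Integer cube roots and the error exponent

cube-root : ∀ x → ∃[ p ] (x ≤ p ^ 3 × p ^ 3 ≤ 8 * x)
cube-root zero = 0 , z≤n , z≤n
cube-root (suc x) with p , x≤p³ , p³≤8x ← cube-root x with suc x ≤? p ^ 3
... | yes x<p³ = p , x<p³ , ≤-trans p³≤8x (*-monoʳ-≤ 8 (n≤1+n x))
-- Here p³ is exactly x, so p has to grow. For p ≥ 1 the new root is at most 2p, which is why a
-- factor 8 = 2³ is lost.
... | no x≮p³ = suc p , ≤-trans (s≤s x≤p³) (1+p³≤[1+p]³ p) , ≤-trans ([1+p]³≤8[1+p³] p) (*-monoʳ-≤ 8 (s≤s (≤-pred (≰⇒> x≮p³))))
  where
  1+p³≤[1+p]³ : ∀ p → suc (p ^ 3) ≤ suc p ^ 3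
  1+p³≤[1+p]³ p = ^-monoˡ-< 3 (n<1+n p)
  [1+p]³≤8[1+p³] : ∀ p → suc p ^ 3 ≤ 8 * suc (p ^ 3)
  [1+p]³≤8[1+p³] zero = s≤s z≤n
  [1+p]³≤8[1+p³] p@(suc _) = begin
    suc p ^ 3     ≤⟨ ^-monoˡ-≤ 3 (+-mono-≤ {1} {p} (s≤s z≤n) (m≤m+n p 0)) ⟩
    (2 * p) ^ 3   ≡⟨ ^-distribʳ-* 3 2 p ⟩
    8 * p ^ 3     ≤⟨ *-monoʳ-≤ 8 (n≤1+n (p ^ 3)) ⟩
    8 * suc (p ^ 3) ∎
    where open ≤-Reasoning

1+p≤2^p : ∀ p → suc p ≤ 2 ^ p
1+p≤2^p zero = ≤-refl
1+p≤2^p (suc p) = begin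
  1 + suc p         ≤⟨ +-mono-≤ (m^n>0 2 p) (1+p≤2^p p) ⟩
  2 ^ p + 2 ^ p     ≡⟨ cong (2 ^ p +_) (+-identityʳ (2 ^ p)) ⟨
  2 ^ suc p         ∎
  where open ≤-Reasoning

-- The number of levels t is at most k + 1; this absorbs it into the error term, through k ≤ 128 k²
-- ≤ p³ < (p + 1)³ ≤ (2^p)³.
1+k≤8^p : ∀ k p → 128 * (k * k) ≤ p ^ 3 → suc k ≤ 8 ^ p
1+k≤8^p zero p _ = m^n>0 8 p
1+k≤8^p k@(suc _) p k≤ = begin
  suc k              ≤⟨ s≤s (≤-trans (m≤m*n k k) (≤-trans (m≤n*m (k * k) 128) k≤)) ⟩
  suc (p ^ 3)        ≤⟨ ^-monoˡ-< 3 (n<1+n p) ⟩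
  suc p ^ 3          ≤⟨ ^-monoˡ-≤ 3 (1+p≤2^p p) ⟩
  (2 ^ p) ^ 3        ≡⟨ trans (^-*-assoc 2 p 3) (trans (cong (2 ^_) (*-comm p 3)) (sym (^-*-assoc 2 3 p))) ⟩
  8 ^ p              ∎
  where open ≤-Reasoning

m+n≤2^[1+s]*c : ∀ s c {a b} → a ≤ 2 ^ s * c → b ≤ 2 ^ s * c → a + b ≤ 2 ^ suc s * c
m+n≤2^[1+s]*c s c {a} {b} a≤ b≤ = begin
  a + b                     ≤⟨ +-mono-≤ a≤ b≤ ⟩
  2 ^ s * c + 2 ^ s * c     ≡⟨ cong (2 ^ s * c +_) (+-identityʳ _) ⟨
  2 * (2 ^ s * c)           ≡⟨ *-assoc 2 (2 ^ s) c ⟨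
  2 ^ suc s * c             ∎
  where open ≤-Reasoning

-- Lists and filters

-- The bound on each `f x` is the quotient c/a. The denominator stays on the left so that quotients
-- such as n!/(n - d)! can be multiplied through several stages without division.
length-concatMap : (f : A → List B) (a c : ℕ) (xs : List A) →
  (∀ {x} → x ∈ xs → length (f x) * a ≤ c) → length (concatMap f xs) * a ≤ length xs * c
length-concatMap f a c [] bound = z≤n
length-concatMap f a c (x ∷ xs) bound = begin
  length (f x ++ concatMap f xs) * a             ≡⟨ cong (_* a) (length-++ (f x)) ⟩
  (length (f x) + length (concatMap f xs)) * a   ≡⟨ *-distribʳ-+ a (length (f x)) _ ⟩
  length (f x) * a + length (concatMap f xs) * a ≤⟨ +-mono-≤ (bound (here refl)) (length-concatMap f a c xs (bound ∘ there)) ⟩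
  c + length xs * c                              ∎
  where open ≤-Reasoning

∈-concatMap : {f : A → List B} {z : B} → x ∈ xs → z ∈ f x → z ∈ concatMap f xs
∈-concatMap {f = f} x∈xs z∈fx = ∈-concatMap⁺ f (Any.map (λ { refl → z∈fx }) x∈xs)

Unique-resp-↭ : xs ↭ ys → Unique xs → Unique ys
Unique-resp-↭ xs↭ys = ↭ₛ.Unique-resp-↭ (setoid _) (↭⇒↭ₛ xs↭ys)

∈⇒↭∷ : x ∈ xs → ∃[ ys ] (xs ↭ x ∷ ys)
∈⇒↭∷ x∈xs with ys , zs , refl ← ∈-∃++ x∈xs = ys ++ zs , shift _ ys zs

-- The elements of xs are pulled out of ys one at a time. As xs has no repetitions, the element
-- pulled out is not asked for again, so the tail still lies in what remains.
unique-⊆⇒↭++ : Unique xs → (∀ {x} → x ∈ xs → x ∈ ys) → ∃[ zs ] (ys ↭ xs ++ zs)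
unique-⊆⇒↭++ {xs = []} {ys} _ _ = ys , ↭-refl
unique-⊆⇒↭++ {xs = x ∷ xs} (x∉xs ∷ uxs) sub with ys′ , ys↭ ← ∈⇒↭∷ (sub (here refl)) =
  let zs , ys′↭ = unique-⊆⇒↭++ uxs sub′ in zs , ↭-trans ys↭ (↭-prep x ys′↭)
  where
  sub′ : ∀ {z} → z ∈ xs → z ∈ ys′
  sub′ z∈xs with ∈-resp-↭ ys↭ (sub (there z∈xs))
  ... | here refl = contradiction refl (All.lookup x∉xs z∈xs)
  ... | there z∈ys′ = z∈ys′

unique-⊆⇒length≤ : Unique xs → (∀ {x} → x ∈ xs → x ∈ ys) → length xs ≤ length ys
unique-⊆⇒length≤ {xs = xs} u sub with zs , ys↭ ← unique-⊆⇒↭++ u sub =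
  subst (length xs ≤_) (sym (trans (↭-length ys↭) (length-++ xs))) (m≤m+n _ _)

unique-⊆⇒↭ : Unique xs → (∀ {x} → x ∈ xs → x ∈ ys) → length xs ≡ length ys → ys ↭ xs
unique-⊆⇒↭ {xs = xs} u sub len with unique-⊆⇒↭++ u sub
... | [] , ys↭ = ↭-trans ys↭ (↭-reflexive (++-identityʳ xs))
... | z ∷ zs , ys↭ = contradiction len (<⇒≢ (subst (length xs <_)
  (sym (trans (↭-length ys↭) (length-++ xs))) (m<m+n (length xs) z<s)))

∈-filterᵇ⁺ : (f : A → Bool) → x ∈ xs → f x ≡ true → x ∈ filterᵇ f xs
∈-filterᵇ⁺ f x∈xs fx = ∈-filter⁺ (T? ∘ f) x∈xs (Equivalence.from T-≡ fx)

∈-filterᵇ⁻ : (f : A → Bool) (xs : List A) → x ∈ filterᵇ f xs → x ∈ xs × f x ≡ true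
∈-filterᵇ⁻ f xs x∈ with x∈xs , fx ← ∈-filter⁻ (T? ∘ f) {xs = xs} x∈ = x∈xs , Equivalence.to T-≡ fx

filterᵇ-cong : {f g : A → Bool} (xs : List A) →
  (∀ {x} → x ∈ xs → f x ≡ g x) → filterᵇ f xs ≡ filterᵇ g xs
filterᵇ-cong [] eq = refl
filterᵇ-cong {f = f} {g} (x ∷ xs) eq with f x | g x | eq (here refl)
... | true  | true  | refl = cong (x ∷_) (filterᵇ-cong xs (eq ∘ there))
... | false | false | refl = filterᵇ-cong xs (eq ∘ there)

filterᵇ-filterᵇ : (f g : A → Bool) (xs : List A) →
  filterᵇ f (filterᵇ g xs) ≡ filterᵇ (λ x → g x ∧ f x) xs
filterᵇ-filterᵇ f g [] = refl
filterᵇ-filterᵇ f g (x ∷ xs) with g x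
... | false = filterᵇ-filterᵇ f g xs
... | true with f x
...   | true  = cong (x ∷_) (filterᵇ-filterᵇ f g xs)
...   | false = filterᵇ-filterᵇ f g xs

filterᵇ-true : {f : A → Bool} (xs : List A) → (∀ {x} → x ∈ xs → f x ≡ true) → filterᵇ f xs ≡ xs
filterᵇ-true [] eq = refl
filterᵇ-true {f = f} (x ∷ xs) eq with f x | eq (here refl)
... | true | refl = cong (x ∷_) (filterᵇ-true xs (eq ∘ there))

filterᵇ-↭ : (f : A → Bool) → xs ↭ ys → filterᵇ f xs ↭ filterᵇ f ys
filterᵇ-↭ f = filter-↭ (T? ∘ f)

length-filterᵇ-split : (f g : A → Bool) (xs : List A) →
  length (filterᵇ f xs) ≡ length (filterᵇ (λ x → f x ∧ g x) xs) + length (filterᵇ (λ x → f x ∧ not (g x)) xs)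
length-filterᵇ-split f g [] = refl
length-filterᵇ-split f g (x ∷ xs) with f x
... | false = length-filterᵇ-split f g xs
... | true with g x
...   | true  = cong suc (length-filterᵇ-split f g xs)
...   | false = trans (cong suc (length-filterᵇ-split f g xs)) (sym (+-suc _ _))

-- Deletion of symbols from strings

infixl 6 _∖_
-- Sets of symbols are Boolean predicates, so that identities between sets reduce to truth tables.
_∖_ : List A → (A → Bool) → List A
xs ∖ f = filterᵇ (not ∘ f) xs

∖-drop : (f : A → Bool) (xs : List A) → f x ≡ true → (x ∷ xs) ∖ f ≡ xs ∖ f
∖-drop {x = x} f xs fx with f x | fx
... | true | refl = refl

∖-keep : (f : A → Bool) (xs : List A) → f x ≡ false → (x ∷ xs) ∖ f ≡ x ∷ xs ∖ f
∖-keep {x = x} f xs fx with f x | fx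
... | false | refl = refl

filterᵇ-accept : (f : A → Bool) (xs : List A) → f x ≡ true → filterᵇ f (x ∷ xs) ≡ x ∷ filterᵇ f xs
filterᵇ-accept {x = x} f xs fx with f x | fx
... | true | refl = refl

filterᵇ-reject : (f : A → Bool) (xs : List A) → f x ≡ false → filterᵇ f (x ∷ xs) ≡ filterᵇ f xs
filterᵇ-reject {x = x} f xs fx with f x | fx
... | false | refl = refl

∉∖ : (f : A → Bool) (xs : List A) → f x ≡ true → x ∉ xs ∖ f
∉∖ f xs fx x∈ with () ← trans (sym (cong not fx)) (proj₂ (∈-filterᵇ⁻ (not ∘ f) xs x∈))

length-∖ : (f : A → Bool) (xs : List A) → length (filterᵇ f xs) + length (xs ∖ f) ≡ length xs
length-∖ f [] = refl
length-∖ f (x ∷ xs) with f x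
... | true  = cong suc (length-∖ f xs)
... | false = trans (+-suc _ _) (cong suc (length-∖ f xs))

length-++-map : (f : A → B) (xs : List B) (ys : List A) →
  length (xs ++ map f ys) ≡ length xs + length ys
length-++-map f xs ys = trans (length-++ xs) (cong (length xs +_) (length-map f ys))

length-map-++-map : (f g : A → B) (xs ys : List A) →
  length (map f xs ++ map g ys) ≡ length xs + length ys
length-map-++-map f g xs ys = trans (length-++-map g (map f xs) ys) (cong (_+ length ys) (length-map f xs))

unique-head : Unique (x ∷ xs) → x ∉ xs
unique-head (x∉xs ∷ _) x∈xs = All.lookup x∉xs x∈xs refl

-- The hypothesis says that h is the union of f and g, phrased through complements because those are
-- what deletion tests.
∖-∖ : (f g h : A → Bool) (xs : List A) → (∀ x → not (f x) ∧ not (g x) ≡ not (h x)) → xs ∖ f ∖ g ≡ xs ∖ h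
∖-∖ f g h xs eq = trans (filterᵇ-filterᵇ (not ∘ g) (not ∘ f) xs) (filterᵇ-cong xs (λ {x} _ → eq x))

∖-[] : (f g : A → Bool) (xs : List A) → (∀ {x} → x ∈ xs → f x ∧ g x ≡ false) → [] ≡ xs ∖ f → xs ∖ g ≡ xs
∖-[] f g [] _ _ = refl
∖-[] f g (x ∷ xs) disjoint eq with f x | g x | disjoint (here refl)
... | true | false | _ = cong (x ∷_) (∖-[] f g xs (disjoint ∘ there) eq)

-- Enumeration of candidates

module Enumeration {V : Set} (_≟_ : DecidableEquality V) where

  open import Data.List.Membership.DecPropositional _≟_ using (_∈?_)

  mem : List V → V → Bool
  mem xs x = does (x ∈? xs)

  -- The enumeration carries sets as lists in arbitrary order; on the symbols of the ambient string,
  -- membership in such a list recovers the original predicate.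
  mem-↭filterᵇ : {us xs : List V} {f : V → Bool} {x : V} → us ↭ filterᵇ f xs → x ∈ xs → mem us x ≡ f x
  mem-↭filterᵇ {us} {xs} {f} {x} us↭ x∈xs with f x in fx
  ... | true  = dec-true (x ∈? us) (∈-resp-↭ (↭-sym us↭) (∈-filterᵇ⁺ f x∈xs fx))
  ... | false = dec-false (x ∈? us) λ x∈us →
    contradiction (trans (sym fx) (proj₂ (∈-filterᵇ⁻ f xs (∈-resp-↭ us↭ x∈us)))) λ ()

  mem-∷-≢ : {x y : V} (xs : List V) → x ≢ y → mem (y ∷ xs) x ≡ mem xs x
  mem-∷-≢ {x} {y} xs x≢y with x ≟ y
  ... | yes x≡y = contradiction x≡y x≢y
  ... | no _    = refl

  mem-∷-≡ : (x : V) (xs : List V) → mem (x ∷ xs) x ≡ true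
  mem-∷-≡ x xs = dec-true (x ∈? (x ∷ xs)) (here refl)

  -- In a string without repetitions a subsequence is determined by its set of symbols. This turns
  -- common subsequences into deletion sets.
  filterᵇ-mem-⊆ : {ws xs : List V} → ws ⊆ xs → Unique xs → filterᵇ (mem ws) xs ≡ ws
  filterᵇ-mem-⊆ [] _ = refl
  filterᵇ-mem-⊆ {ws} {x ∷ xs} (x ∷ʳ ws⊆xs) ux@(_ ∷ uxs) =
    trans (filterᵇ-reject (mem ws) xs (dec-false (x ∈? ws) (unique-head ux ∘ Sublist.lookup ws⊆xs)))
          (filterᵇ-mem-⊆ ws⊆xs uxs)
  filterᵇ-mem-⊆ {x ∷ ws} {x ∷ xs} (refl ∷ ws⊆xs) ux@(_ ∷ uxs) =
    trans (filterᵇ-accept (mem (x ∷ ws)) xs (mem-∷-≡ x ws)) (cong (x ∷_) (trans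
      (filterᵇ-cong xs (λ z∈xs → mem-∷-≢ ws λ { refl → unique-head ux z∈xs }))
      (filterᵇ-mem-⊆ ws⊆xs uxs)))

  remove : V → List V → List V
  remove x xs = xs ∖ (λ y → does (y ≟ x))

  remove-unique : {x : V} {xs : List V} → Unique xs → Unique (remove x xs)
  remove-unique = Unique.filter⁺ _

  remove-∉ : {x : V} (xs : List V) → x ∉ xs → remove x xs ≡ xs
  remove-∉ {x} xs x∉xs = filterᵇ-true xs λ {y} y∈xs → cong not (dec-false (y ≟ x) λ { refl → x∉xs y∈xs })

  remove-head : {x : V} {xs : List V} → Unique (x ∷ xs) → remove x (x ∷ xs) ≡ xs
  remove-head {x} {xs} u = trans (∖-drop (λ y → does (y ≟ x)) xs (dec-true (x ≟ x) refl)) (remove-∉ xs (unique-head u))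

  remove-↭ : {x : V} {xs ys : List V} → Unique ys → ys ↭ x ∷ xs → xs ↭ remove x ys
  remove-↭ {x} u ys↭ = ↭-trans (↭-reflexive (sym (remove-head (Unique-resp-↭ ys↭ u))))
    (↭-sym (filterᵇ-↭ (λ y → not (does (y ≟ x))) ys↭))

  filterᵇ-remove-↭ : {x : V} {xs ys : List V} (f : V → Bool) → Unique ys → ys ↭ x ∷ xs → f x ≡ true →
    filterᵇ f ys ↭ x ∷ filterᵇ f (remove x ys)
  filterᵇ-remove-↭ {x} {xs} f u ys↭ fx = ↭-trans (filterᵇ-↭ f ys↭)
    (↭-trans (↭-reflexive (filterᵇ-accept f xs fx)) (↭-prep x (filterᵇ-↭ f (remove-↭ u ys↭))))

  remove-∖ : {x : V} (f : V → Bool) (xs : List V) → f x ≡ true → remove x xs ∖ f ≡ xs ∖ f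
  remove-∖ {x} f xs fx = trans (filterᵇ-filterᵇ _ _ xs) (filterᵇ-cong xs λ {y} _ → eq y)
    where
    eq : ∀ y → not (does (y ≟ x)) ∧ not (f y) ≡ not (f y)
    eq y with y ≟ x
    ... | yes refl = sym (cong not fx)
    ... | no _     = refl

  remove-⊆ : {x : V} (xs : List V) → remove x xs ⊆ xs
  remove-⊆ {x} xs = filter-⊆ (T? ∘ (λ y → not (does (y ≟ x)))) xs

  -- Choices of s symbols to delete so that α and β agree on the r remaining
  -- ones: when the two first symbols differ, one of them has to be deleted.
  mutual

    covers : List V → List V → (r s : ℕ) → List (List V)
    covers [] _ zero zero = [] ∷ []
    covers [] _ _ _ = []
    covers (_ ∷ _) [] _ _ = []
    covers (x ∷ α) (y ∷ β) r s with x ≟ y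
    ... | yes _ = keeping α β r s ++ map (x ∷_) (deleting α β r s)
    -- A symbol deleted from the front of one string is removed from the other as well, so both keep
    -- the same set of symbols and no symbol is chosen twice.
    ... | no _  = map (x ∷_) (deleting α (remove x (y ∷ β)) r s) ++ map (y ∷_) (deleting (remove y (x ∷ α)) β r s)

    keeping deleting : List V → List V → (r s : ℕ) → List (List V)
    keeping _ _ zero s = []
    keeping α β (suc r) s = covers α β r s
    deleting _ _ r zero = []
    deleting α β r (suc s) = covers α β r s

  -- An upper bound on the length of a longest common subsequence. For permutations at Ulam distance
  -- k it holds with M = n - k.
  CommonBound : List V → List V → ℕ → Set
  CommonBound α β M = ∀ {ws} → ws ⊆ α → ws ⊆ β → length ws ≤ M

  commonBound-tails : {M : ℕ} {α β : List V} {x : V} → CommonBound (x ∷ α) (x ∷ β) (suc M) → CommonBound α β M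
  commonBound-tails bound w⊆α w⊆β = ≤-pred (bound (refl ∷ w⊆α) (refl ∷ w⊆β))

  commonBound-⊆ : {M : ℕ} {α α′ β β′ : List V} → α ⊆ α′ → β ⊆ β′ → CommonBound α′ β′ M → CommonBound α β M
  commonBound-⊆ α⊆ β⊆ bound w⊆α w⊆β = bound (⊆-trans w⊆α α⊆) (⊆-trans w⊆β β⊆)

  mutual

    -- A mismatch doubles the number of choices and spends one of the s deletions. A match lowers M
    -- by one, because the shared head prolongs every common subsequence of the tails, and Pascal's
    -- rule adds the branches that keep and delete it.
    length-covers : ∀ (α β : List V) r s M → CommonBound α β M → length (covers α β r s) ≤ 2 ^ s * (M choose r)
    length-covers [] β zero zero M bound = ≤-refl
    length-covers [] β zero (suc s) M bound = z≤n
    length-covers [] β (suc r) s M bound = z≤n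
    length-covers (x ∷ α) [] r s M bound = z≤n
    length-covers (x ∷ α) (y ∷ β) r s M bound with x ≟ y
    length-covers (x ∷ α) (y ∷ β) r s zero bound | yes refl =
      contradiction (bound (refl ∷ minimum α) (refl ∷ minimum β)) λ ()
    length-covers (x ∷ α) (y ∷ β) r s (suc M) bound | yes refl =
      subst (_≤ 2 ^ s * (suc M choose r)) (sym (length-++-map (x ∷_) (keeping α β r s) (deleting α β r s)))
        (length-keeping+deleting α β r s M (commonBound-tails bound))
    length-covers (x ∷ α) (y ∷ β) r zero M bound | no _ = z≤n
    length-covers (x ∷ α) (y ∷ β) r (suc s) M bound | no _ =
      subst (_≤ 2 ^ suc s * (M choose r)) (sym (length-map-++-map (x ∷_) (y ∷_) (covers α (remove x (y ∷ β)) r s) _))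
        (m+n≤2^[1+s]*c s (M choose r)
          (length-covers α (remove x (y ∷ β)) r s M
            (commonBound-⊆ (x ∷ʳ ⊆-refl) (remove-⊆ (y ∷ β)) bound))
          (length-covers (remove y (x ∷ α)) β r s M
            (commonBound-⊆ (remove-⊆ (x ∷ α)) (y ∷ʳ ⊆-refl) bound)))

    length-keeping+deleting : ∀ (α β : List V) r s M → CommonBound α β M →
      length (keeping α β r s) + length (deleting α β r s) ≤ 2 ^ s * (suc M choose r)
    length-keeping+deleting α β zero zero M bound = z≤n
    length-keeping+deleting α β zero (suc s) M bound = ≤-trans (length-covers α β zero s M bound)
      (*-monoˡ-≤ 1 (^-monoʳ-≤ 2 (n≤1+n s)))
    length-keeping+deleting α β (suc r) zero M bound = begin
      length (covers α β r zero) + 0   ≡⟨ +-identityʳ _ ⟩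
      length (covers α β r zero)       ≤⟨ length-covers α β r zero M bound ⟩
      1 * (M choose r)                 ≤⟨ *-monoʳ-≤ 1 (m≤m+n (M choose r) (M choose suc r)) ⟩
      1 * (M choose r + M choose suc r) ≡⟨ cong (1 *_) (nCk+nC[k+1]≡[n+1]C[k+1] M r) ⟩
      1 * (suc M choose suc r)         ∎
      where open ≤-Reasoning
    length-keeping+deleting α β (suc r) (suc s) M bound = begin
      length (covers α β r (suc s)) + length (covers α β (suc r) s)
        ≤⟨ +-mono-≤ (length-covers α β r (suc s) M bound) (length-covers α β (suc r) s M bound) ⟩
      2 ^ suc s * (M choose r) + 2 ^ s * (M choose suc r)
        ≤⟨ +-monoʳ-≤ (2 ^ suc s * (M choose r)) (*-monoˡ-≤ (M choose suc r) (^-monoʳ-≤ 2 (n≤1+n s))) ⟩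
      2 ^ suc s * (M choose r) + 2 ^ suc s * (M choose suc r)
        ≡⟨ *-distribˡ-+ (2 ^ suc s) (M choose r) (M choose suc r) ⟨
      2 ^ suc s * (M choose r + M choose suc r)
        ≡⟨ cong (2 ^ suc s *_) (nCk+nC[k+1]≡[n+1]C[k+1] M r) ⟩
      2 ^ suc s * (suc M choose suc r) ∎
      where open ≤-Reasoning

  -- The predicate f selects the branch: at a mismatch at least one head lies in f, since otherwise
  -- the two remainders would start with different symbols. The set is recovered up to order only,
  -- because symbols are listed as they are deleted, possibly from the front of β.
  covers-complete : ∀ (α β : List V) r s (f : V → Bool) → Unique α → Unique β → α ↭ β → α ∖ f ≡ β ∖ f →
    length (α ∖ f) ≡ r → length (filterᵇ f α) ≡ s → ∃[ us ] (us ∈ covers α β r s × us ↭ filterᵇ f α)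
  covers-complete [] β r s f uα uβ α↭β eq refl refl = [] , here refl , ↭-refl
  covers-complete (x ∷ α) [] r s f uα uβ α↭β eq _ _ = contradiction α↭β ¬x∷xs↭[]
  covers-complete (x ∷ α) (y ∷ β) r s f uα@(_ ∷ uα′) uβ@(_ ∷ uβ′) α↭β eq eqr eqs with x ≟ y | f x in fx
  covers-complete (x ∷ α) (y ∷ β) r (suc s) f uα@(_ ∷ uα′) uβ@(_ ∷ uβ′) α↭β eq eqr eqs | yes refl | true
    with us , us∈ , us↭ ← covers-complete α β r s f uα′ uβ′ (drop-∷ α↭β) (trans eq (∖-drop f β fx)) eqr (suc-injective eqs)
    = x ∷ us , ∈-++⁺ʳ (keeping α β r (suc s)) (∈-map⁺ (x ∷_) us∈) , ↭-prep x us↭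
  covers-complete (x ∷ α) (y ∷ β) (suc r) s f uα@(_ ∷ uα′) uβ@(_ ∷ uβ′) α↭β eq eqr eqs | yes refl | false
    with us , us∈ , us↭ ← covers-complete α β r s f uα′ uβ′ (drop-∷ α↭β) (∷-injectiveʳ (trans eq (∖-keep f β fx))) (suc-injective eqr) eqs
    = us , ∈-++⁺ˡ us∈ , us↭
  covers-complete (x ∷ α) (y ∷ β) r (suc s) f uα@(_ ∷ uα′) uβ@(_ ∷ uβ′) α↭β eq eqr eqs | no x≢y | true
    with us , us∈ , us↭ ← covers-complete α (remove x (y ∷ β)) r s f uα′ (remove-unique uβ)
      (remove-↭ uβ (↭-sym α↭β)) (trans eq (sym (remove-∖ f (y ∷ β) fx))) eqr (suc-injective eqs)
    = x ∷ us , ∈-++⁺ˡ (∈-map⁺ (x ∷_) us∈) , ↭-prep x us↭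
  covers-complete (x ∷ α) (y ∷ β) r s f uα@(_ ∷ uα′) uβ@(_ ∷ uβ′) α↭β eq eqr eqs | no x≢y | false with f y in fy
  ... | false = contradiction (∷-injectiveˡ eq) x≢y
  ... | true
    with filterᵇ↭ ← ↭-trans (↭-reflexive (sym (filterᵇ-reject f α fx))) (filterᵇ-remove-↭ f uα α↭β fy)
       | α′∖f ← trans (remove-∖ f (x ∷ α) fy) (∖-keep f α fx)
    -- The symbol y is among the deleted symbols of x ∷ α, which forces s to be positive.
    with s | trans (sym eqs) (↭-length filterᵇ↭)
  ...   | suc s′ | eqs′
    with us , us∈ , us↭ ← covers-complete (remove y (x ∷ α)) β r s′ f (remove-unique uα) uβ′ (↭-sym (remove-↭ uα α↭β))
           (trans α′∖f eq) (trans (cong length α′∖f) eqr) (sym (suc-injective eqs′))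
    = y ∷ us , ∈-++⁺ʳ (map (x ∷_) (covers α (remove x (y ∷ β)) r s′)) (∈-map⁺ (y ∷_) us∈)
    , ↭-trans (↭-prep y us↭) (↭-sym filterᵇ↭)

  -- Triples (A ∩ B, A, B) of sublists of us with A ∪ B = us, where A ∩ B and
  -- the symmetric difference of A and B have d and b elements respectively.
  mutual

    splits : List V → (d b : ℕ) → List (List V × List V × List V)
    splits [] zero zero = ([] , [] , []) ∷ []
    splits [] _ _ = []
    splits (u ∷ us) d b =
      map (λ (ds , as , bs) → u ∷ ds , u ∷ as , u ∷ bs) (inBoth us d b) ++
      (map (λ (ds , as , bs) → ds , u ∷ as , bs) (inOne us d b) ++
       map (λ (ds , as , bs) → ds , as , u ∷ bs) (inOne us d b))

    inBoth inOne : List V → (d b : ℕ) → List (List V × List V × List V)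
    inBoth us zero b = []
    inBoth us (suc d) b = splits us d b
    inOne us d zero = []
    inOne us d (suc b) = splits us d b

  mutual

    -- A split amounts to choosing b of d + b places for the symmetric difference and a side for
    -- each of them; the recursion is Pascal's rule weighted by 2^b.
    length-splits : ∀ us d b → length (splits us d b) ≤ 2 ^ b * ((d + b) choose b)
    length-splits [] zero zero = ≤-refl
    length-splits [] zero (suc b) = z≤n
    length-splits [] (suc d) b = z≤n
    length-splits (u ∷ us) d b = subst (_≤ 2 ^ b * ((d + b) choose b))
      (sym (trans (length-++ (map _ (inBoth us d b)))
        (cong₂ _+_ (length-map _ (inBoth us d b)) (length-map-++-map _ _ (inOne us d b) (inOne us d b)))))
      (length-inBoth+inOne us d b)

    length-inBoth+inOne : ∀ us d b →
      length (inBoth us d b) + (length (inOne us d b) + length (inOne us d b)) ≤ 2 ^ b * ((d + b) choose b)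
    length-inBoth+inOne us zero zero = z≤n
    length-inBoth+inOne us zero (suc b) = m+n≤2^[1+s]*c b (suc b choose suc b) bound bound
      where
      bound : length (splits us zero b) ≤ 2 ^ b * (suc b choose suc b)
      bound = ≤-trans (length-splits us zero b)
        (≤-reflexive (cong (2 ^ b *_) (trans (nCn≡1 b) (sym (nCn≡1 (suc b))))))
    length-inBoth+inOne us (suc d) zero = subst (_≤ 1) (sym (+-identityʳ _)) (length-splits us d zero)
    length-inBoth+inOne us (suc d) (suc b) = begin
      length (splits us d (suc b)) + (length (splits us (suc d) b) + length (splits us (suc d) b))
        ≤⟨ +-mono-≤ (length-splits us d (suc b)) (m+n≤2^[1+s]*c b _ (length-splits us (suc d) b) (length-splits us (suc d) b)) ⟩
      2 ^ suc b * ((d + suc b) choose suc b) + 2 ^ suc b * ((suc d + b) choose b)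
        ≡⟨ *-distribˡ-+ (2 ^ suc b) ((d + suc b) choose suc b) _ ⟨
      2 ^ suc b * (((d + suc b) choose suc b) + ((suc d + b) choose b))
        ≡⟨ cong (2 ^ suc b *_) (pascal d b) ⟩
      2 ^ suc b * ((suc d + suc b) choose suc b) ∎
      where
      open ≤-Reasoning
      pascal : ∀ d b → ((d + suc b) choose suc b) + ((suc d + b) choose b) ≡ (suc d + suc b) choose suc b
      pascal d b rewrite +-suc d b =
        trans (+-comm (suc (d + b) choose suc b) _) (nCk+nC[k+1]≡[n+1]C[k+1] (suc d + b) b)

  splits-complete : ∀ us d b (f g : V → Bool) → (∀ {x} → x ∈ us → f x ∨ g x ≡ true) →
    length (filterᵇ (λ x → f x ∧ g x) us) ≡ d →
    length (filterᵇ (λ x → f x ∧ not (g x)) us) + length (filterᵇ (λ x → g x ∧ not (f x)) us) ≡ b →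
    (filterᵇ (λ x → f x ∧ g x) us , filterᵇ f us , filterᵇ g us) ∈ splits us d b
  splits-complete [] zero zero f g f∨g refl refl = here refl
  splits-complete (u ∷ us) d b f g f∨g eqd eqb with f u | g u | f∨g (here refl)
  splits-complete (u ∷ us) (suc d) b f g f∨g eqd eqb | true | true | _ =
    ∈-++⁺ˡ (∈-map⁺ _ (splits-complete us d b f g (f∨g ∘ there) (suc-injective eqd) eqb))
  splits-complete (u ∷ us) d (suc b) f g f∨g eqd eqb | true | false | _ =
    ∈-++⁺ʳ (map _ (inBoth us d (suc b))) (∈-++⁺ˡ (∈-map⁺ _
      (splits-complete us d b f g (f∨g ∘ there) eqd (suc-injective eqb))))
  splits-complete (u ∷ us) d b f g f∨g eqd eqb | false | true | _ with b | trans (sym (+-suc _ _)) eqb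
  ... | suc b′ | eqb′ =
    ∈-++⁺ʳ (map _ (inBoth us d (suc b′))) (∈-++⁺ʳ (map _ (inOne us d (suc b′))) (∈-map⁺ _
      (splits-complete us d b′ f g (f∨g ∘ there) eqd (suc-injective eqb′))))

  -- Common superstrings of xs and ys with at most b symbols outside their common part.
  merges : List V → List V → ℕ → List (List V)
  merges [] ys b = ys ∷ []
  merges (x ∷ xs) [] b = (x ∷ xs) ∷ []
  merges (x ∷ xs) (y ∷ ys) b with x ≟ y
  merges (x ∷ xs) (y ∷ ys) b | yes _ = map (x ∷_) (merges xs ys b)
  merges (x ∷ xs) (y ∷ ys) zero | no _ = []
  merges (x ∷ xs) (y ∷ ys) (suc b) | no _ =
    map (x ∷_) (merges xs (y ∷ ys) b) ++ map (y ∷_) (merges (x ∷ xs) ys b)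

  length-merges : ∀ xs ys b → length (merges xs ys b) ≤ 2 ^ b
  length-merges [] ys b = m^n>0 2 b
  length-merges (x ∷ xs) [] b = m^n>0 2 b
  length-merges (x ∷ xs) (y ∷ ys) b with x ≟ y
  length-merges (x ∷ xs) (y ∷ ys) b | yes _ =
    subst (_≤ 2 ^ b) (sym (length-map (x ∷_) (merges xs ys b))) (length-merges xs ys b)
  length-merges (x ∷ xs) (y ∷ ys) zero | no _ = z≤n
  length-merges (x ∷ xs) (y ∷ ys) (suc b) | no _ =
    subst₂ _≤_ (sym (length-map-++-map (x ∷_) (y ∷_) (merges xs (y ∷ ys) b) (merges (x ∷ xs) ys b))) (cong (2 ^ b +_) (sym (+-identityʳ _)))
      (+-mono-≤ (length-merges xs (y ∷ ys) b) (length-merges (x ∷ xs) ys b))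

  -- The head z of γ lies in at most one of f and g. If in neither, both strings start with z. If in
  -- f alone, z starts ys but does not occur in xs, so the heads differ and one unit of b pays for
  -- z. Hence equal heads never need a branching.
  merges-complete : ∀ γ (f g : V → Bool) {xs ys} b → (∀ {x} → x ∈ γ → f x ∧ g x ≡ false) →
    length (filterᵇ f γ) + length (filterᵇ g γ) ≤ b →
    xs ≡ γ ∖ f → ys ≡ γ ∖ g → γ ∈ merges xs ys b
  merges-complete [] f g b disjoint len refl refl = here refl
  merges-complete (z ∷ γ) f g b disjoint len eqx eqy with f z in fz | g z in gz | disjoint (here refl)
  merges-complete (z ∷ γ) f g b disjoint len refl refl | false | false | _ with z ≟ z
  ... | yes _ = ∈-map⁺ (z ∷_) (merges-complete γ f g b (disjoint ∘ there) len refl refl)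
  ... | no z≢z = contradiction refl z≢z
  merges-complete (z ∷ γ) f g {[]} b disjoint len eqx refl | true | false | _ =
    here (cong (z ∷_) (sym (∖-[] f g γ (disjoint ∘ there) eqx)))
  merges-complete (z ∷ γ) f g {x ∷ xs} (suc b) disjoint (s≤s len) eqx refl | true | false | _ with x ≟ z
  ... | yes refl = contradiction (subst (x ∈_) eqx (here refl)) (∉∖ f γ fz)
  ... | no _ = ∈-++⁺ʳ (map (x ∷_) (merges xs (z ∷ γ ∖ g) b))
    (∈-map⁺ (z ∷_) (merges-complete γ f g b (disjoint ∘ there) len eqx refl))
  merges-complete (z ∷ γ) f g {_} {[]} b disjoint len refl eqy | false | true | _ =
    here (cong (z ∷_) (sym (∖-[] g f γ (λ {x} x∈γ → trans (∧-comm (g x) (f x)) (disjoint (there x∈γ))) eqy)))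
  merges-complete (z ∷ γ) f g {_} {y ∷ ys} b disjoint len refl eqy | false | true | _ with z ≟ y
  ... | yes refl = contradiction (subst (z ∈_) eqy (here refl)) (∉∖ g γ gz)
  ... | no _ with b | ≤-trans (≤-reflexive (sym (+-suc _ _))) len
  ...   | suc b′ | s≤s len′ = ∈-++⁺ˡ (∈-map⁺ (z ∷_) (merges-complete γ f g b′ (disjoint ∘ there) len′ refl eqy))

  insertions : ℕ → V → List V → List (List V)
  insertions N x w = map (λ i → take i w ++ x ∷ drop i w) (upTo N)

  ∈-insertions : ∀ x ys zs {N} → length ys < N → ys ++ x ∷ zs ∈ insertions N x (ys ++ zs)
  ∈-insertions x ys zs {N} ys<N = subst (_∈ insertions N x (ys ++ zs))
    (cong₂ (λ us vs → us ++ x ∷ vs) (take-++ ys) (drop-++ ys))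
    (∈-map⁺ (λ i → take i (ys ++ zs) ++ x ∷ drop i (ys ++ zs)) (∈-upTo⁺ ys<N))
    where
    take-++ : ∀ ys → take (length ys) (ys ++ zs) ≡ ys
    take-++ [] = refl
    take-++ (y ∷ ys) = cong (y ∷_) (take-++ ys)
    drop-++ : ∀ ys → drop (length ys) (ys ++ zs) ≡ zs
    drop-++ [] = refl
    drop-++ (y ∷ ys) = drop-++ ys

  -- N is the final length. Counting positions up to N, instead of up to the
  -- length of w, bounds the number of results by N!/(N−d)! for every w.
  insertAll : (N d : ℕ) → List V → List V → List (List V)
  insertAll N zero _ w = w ∷ []
  insertAll N (suc d) [] w = []
  -- The other symbols are inserted first, towards length N - 1; then x has N slots.
  insertAll N (suc d) (x ∷ ds) w = concatMap (insertions N x) (insertAll (N ∸ 1) d ds w)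

  length-insertAll : ∀ N d ds w → d ≤ N → length (insertAll N d ds w) * (N ∸ d) ! ≤ N !
  length-insertAll N zero ds w _ = ≤-reflexive (+-identityʳ (N !))
  length-insertAll N (suc d) [] w _ = z≤n
  length-insertAll (suc N) (suc d) (x ∷ ds) w (s≤s d≤N) = begin
    length (concatMap (insertions (suc N) x) ws) * (N ∸ d) !
      ≤⟨ length-concatMap (insertions (suc N) x) ((N ∸ d) !) (suc N * (N ∸ d) !) ws
           (λ {v} _ → ≤-reflexive (cong (_* (N ∸ d) !) (trans (length-map _ (upTo (suc N))) (length-upTo (suc N))))) ⟩
    length ws * (suc N * (N ∸ d) !)   ≡⟨ lemma (length ws) (suc N) ((N ∸ d) !) ⟩
    suc N * (length ws * (N ∸ d) !)   ≤⟨ *-monoʳ-≤ (suc N) (length-insertAll N d ds w d≤N) ⟩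
    suc N * N !                       ∎
    where
    open ≤-Reasoning
    ws = insertAll N d ds w
    lemma : ∀ x y z → x * (y * z) ≡ y * (x * z)
    lemma = solve-∀

  -- Take x out of γ, rebuild the rest by induction, and put x back at its own position. Since x
  -- occurs once in γ, deleting ds from the rest gives the same string as deleting x ∷ ds from γ.
  insertAll-complete : ∀ N d ds γ → length ds ≡ d → Unique ds → (∀ {x} → x ∈ ds → x ∈ γ) →
    Unique γ → length γ ≡ N → γ ∈ insertAll N d ds (γ ∖ mem ds)
  insertAll-complete N zero [] γ _ _ _ _ _ = here (sym (filterᵇ-true γ (λ _ → refl)))
  insertAll-complete N (suc d) (x ∷ ds) γ eqd ux@(_ ∷ uds) sub uγ eqN
    with ys , zs , refl ← ∈-∃++ (sub (here refl))
    with N | trans (sym eqN) (trans (length-++ ys) (+-suc (length ys) (length zs)))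
  ... | suc N′ | eqN′ =
    ∈-concatMap ih (∈-insertions x ys zs (subst (length ys <_) (sym eqN′) (s≤s (m≤m+n _ _))))
    where
    shifted : Unique (x ∷ ys ++ zs)
    shifted = Unique-resp-↭ (shift x ys zs) uγ
    sub′ : ∀ {z} → z ∈ ds → z ∈ ys ++ zs
    sub′ z∈ds with ∈-resp-↭ (shift x ys zs) (sub (there z∈ds))
    ... | here refl = contradiction z∈ds (unique-head ux)
    ... | there z∈ = z∈
    agree : ∀ {z} → z ∈ ys ++ zs → not (mem ds z) ≡ not (mem (x ∷ ds) z)
    agree z∈ = cong not (sym (mem-∷-≢ ds λ { refl → unique-head shifted z∈ }))
    same : (ys ++ zs) ∖ mem ds ≡ (ys ++ x ∷ zs) ∖ mem (x ∷ ds)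
    same = trans (filterᵇ-cong (ys ++ zs) agree)
      (trans (filter-++ _ ys zs) (sym (trans (filter-++ _ ys (x ∷ zs))
        (cong (ys ∖ mem (x ∷ ds) ++_) (∖-drop (mem (x ∷ ds)) zs (mem-∷-≡ x ds))))))
    unique′ : Unique (ys ++ zs)
    unique′ with _ ∷ u ← shifted = u
    ih : ys ++ zs ∈ insertAll N′ d ds ((ys ++ x ∷ zs) ∖ mem (x ∷ ds))
    ih = subst (λ w → ys ++ zs ∈ insertAll N′ d ds w) same
      (insertAll-complete N′ d ds (ys ++ zs) (suc-injective eqd) uds sub′ unique′
        (trans (length-++ ys) (sym (suc-injective eqN′))))

  -- r, d and t stand for n − |A ∪ B|, |A ∩ B| and |A \ B| = |B \ A|.
  candidatesAt : (α β : List V) (r d t : ℕ) → List (List V)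
  candidatesAt α β r d t = concatMap forCover (covers α β r (d + t + t))
    module CandidatesAt where
    forSplit : List V × List V × List V → List (List V)
    forSplit (ds , as , bs) = concatMap (insertAll (length α) d ds) (merges (α ∖ mem as) (β ∖ mem bs) (t + t))
    forCover : List V → List (List V)
    forCover us = concatMap forSplit (splits us d (t + t))

  -- The insertions contribute n!/(n - d)!, so both sides are multiplied by (n - d)!. Since n - d =
  -- r + t + t, `level-bound` then bounds the remaining counts times (n - k)!.
  length-candidatesAt : ∀ α β r d t p → length α ≡ r + t + (d + t) → CommonBound α β (r + t) →
    128 * ((d + t) * (d + t)) ≤ p ^ 3 →
    length (candidatesAt α β r d t) * (r + t) ! ≤ 2 ^ (d + t) * 64 ^ p * (length α) !
  length-candidatesAt α β r d t p n≡ bound k≤p =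
    *-cancelʳ-≤ _ _ (n∸d !) {{n∸d !≢0}} (begin
      L * N ! * n∸d !                   ≡⟨ lemma L (N !) (n∸d !) ⟩
      L * n∸d ! * N !                   ≤⟨ *-monoˡ-≤ (N !) total ⟩
      c₁ * (c₂ * (c₃ * n !)) * N !      ≡⟨ lemma′ c₁ c₂ c₃ (n !) (N !) ⟩
      c₁ * (c₂ * c₃) * N ! * n !        ≤⟨ *-monoˡ-≤ (n !) (level-bound r t d p k≤p) ⟩
      2 ^ (d + t) * 64 ^ p * (N + t) ! * n ! ≡⟨ cong (λ x → 2 ^ (d + t) * 64 ^ p * x ! * n !) N+t≡ ⟩
      2 ^ (d + t) * 64 ^ p * n∸d ! * n ! ≡⟨ lemma (2 ^ (d + t) * 64 ^ p) (n∸d !) (n !) ⟩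
      2 ^ (d + t) * 64 ^ p * n ! * n∸d ! ∎)
    where
    open ≤-Reasoning
    open CandidatesAt α β r d t
    n = length α
    N = r + t
    n∸d = n ∸ d
    L = length (candidatesAt α β r d t)
    c₁ = 2 ^ (d + t + t) * (N choose r)
    c₂ = 2 ^ (t + t) * ((d + (t + t)) choose (t + t))
    c₃ = 2 ^ (t + t)
    n≡d+N+t : n ≡ d + (N + t)
    n≡d+N+t = trans n≡ (rearrange r t d)
      where
      rearrange : ∀ r t d → r + t + (d + t) ≡ d + (r + t + t)
      rearrange = solve-∀
    N+t≡ : N + t ≡ n∸d
    N+t≡ = sym (trans (cong (_∸ d) n≡d+N+t) (m+n∸m≡n d (N + t)))
    d≤n : d ≤ n
    d≤n = subst (d ≤_) (sym n≡d+N+t) (m≤m+n d (N + t))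
    lemma : ∀ x y z → x * y * z ≡ x * z * y
    lemma = solve-∀
    lemma′ : ∀ x y z w v → x * (y * (z * w)) * v ≡ x * (y * z) * v * w
    lemma′ = solve-∀
    perSplit : ∀ {s} → length (forSplit s) * n∸d ! ≤ c₃ * n !
    perSplit {ds , as , bs} = ≤-trans
      (length-concatMap (insertAll n d ds) (n∸d !) (n !) (merges (α ∖ mem as) (β ∖ mem bs) (t + t))
        (λ {w} _ → length-insertAll n d ds w d≤n))
      (*-monoˡ-≤ (n !) (length-merges (α ∖ mem as) (β ∖ mem bs) (t + t)))
    perCover : ∀ {us} → length (forCover us) * n∸d ! ≤ c₂ * (c₃ * n !)
    perCover {us} = ≤-trans
      (length-concatMap forSplit (n∸d !) (c₃ * n !) (splits us d (t + t)) (λ {s} _ → perSplit {s}))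
      (*-monoˡ-≤ (c₃ * n !) (length-splits us d (t + t)))
    total : L * n∸d ! ≤ c₁ * (c₂ * (c₃ * n !))
    total = ≤-trans
      (length-concatMap forCover (n∸d !) (c₂ * (c₃ * n !)) (covers α β r (d + t + t)) (λ {us} _ → perCover {us}))
      (*-monoˡ-≤ (c₂ * (c₃ * n !)) (length-covers α β r (d + t + t) N bound))

  -- The range of t is that of |A - B|: this set lies in A, which has k symbols, and in the
  -- complement of B, which has n - k. Within this range, for k ≤ n, both truncated subtractions are
  -- exact.
  candidates : (α β : List V) (k : ℕ) → List (List V)
  candidates α β k = concatMap (λ t → candidatesAt α β (length α ∸ (k + t)) (k ∸ t) t)
    (upTo (suc (k ⊓ (length α ∸ k))))

  -- There are at most 8^p levels with at most 2^k 64^p n!/(n - k)! candidates each; the 9 in the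
  -- exponent comes from 8 · 64 = 2^9.
  length-candidates : ∀ α β k p {n} → length α ≡ n → k ≤ n → CommonBound α β (n ∸ k) → 128 * (k * k) ≤ p ^ 3 →
    length (candidates α β k) * (n ∸ k) ! ≤ 2 ^ (k + 9 * p) * n !
  length-candidates α β k p refl k≤n bound k≤p = begin
    length (candidates α β k) * N !
      ≤⟨ length-concatMap (λ t → candidatesAt α β (n ∸ (k + t)) (k ∸ t) t) (N !) (2 ^ k * 64 ^ p * n !) (upTo (suc (k ⊓ N))) (λ t∈ → perLevel (≤-pred (∈-upTo⁻ t∈))) ⟩
    length (upTo (suc (k ⊓ N))) * (2 ^ k * 64 ^ p * n !)
      ≡⟨ cong (_* (2 ^ k * 64 ^ p * n !)) (length-upTo (suc (k ⊓ N))) ⟩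
    suc (k ⊓ N) * (2 ^ k * 64 ^ p * n !)
      ≤⟨ *-monoˡ-≤ (2 ^ k * 64 ^ p * n !) (≤-trans (s≤s (m⊓n≤m k N)) (1+k≤8^p k p k≤p)) ⟩
    8 ^ p * (2 ^ k * 64 ^ p * n !)
      ≡⟨ lemma (8 ^ p) (2 ^ k) (64 ^ p) (n !) ⟩
    2 ^ k * (8 ^ p * 64 ^ p) * n !
      ≡⟨ cong (λ x → 2 ^ k * x * n !) (trans (sym (^-distribʳ-* p 8 64)) (^-*-assoc 2 9 p)) ⟩
    2 ^ k * 2 ^ (9 * p) * n !
      ≡⟨ cong (_* n !) (^-distribˡ-+-* 2 k (9 * p)) ⟨
    2 ^ (k + 9 * p) * n ! ∎
    where
    open ≤-Reasoning
    n = length α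
    N = n ∸ k
    lemma : ∀ x y z w → x * (y * z * w) ≡ y * (x * z) * w
    lemma = solve-∀
    perLevel : ∀ {t} → t ≤ k ⊓ N →
      length (candidatesAt α β (n ∸ (k + t)) (k ∸ t) t) * N ! ≤ 2 ^ k * 64 ^ p * n !
    perLevel {t} t≤ = subst₂ (λ x y → length (candidatesAt α β (n ∸ (k + t)) (k ∸ t) t) * x ! ≤ 2 ^ y * 64 ^ p * n !) r+t≡ d+t≡
      (length-candidatesAt α β (n ∸ (k + t)) (k ∸ t) t p
        (trans (sym (m∸n+n≡m k≤n)) (sym (cong₂ _+_ r+t≡ d+t≡)))
        (subst (CommonBound α β) (sym r+t≡) bound)
        (subst (λ x → 128 * (x * x) ≤ p ^ 3) (sym d+t≡) k≤p))
      where
      d+t≡ : k ∸ t + t ≡ k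
      d+t≡ = m∸n+n≡m (≤-trans t≤ (m⊓n≤m k N))
      r+t≡ : n ∸ (k + t) + t ≡ N
      r+t≡ = trans (cong (_+ t) (sym (∸-+-assoc n k t))) (m∸n+n≡m (≤-trans t≤ (m⊓n≤n k N)))

  -- Completeness of the enumeration

  module _ (α β γ : List V) (a b : V → Bool) (uα : Unique α) (α↭β : α ↭ β) (α↭γ : α ↭ γ)
    (α∖a : α ∖ a ≡ γ ∖ a) (β∖b : β ∖ b ≡ γ ∖ b) where

    a∨b a∧b a∧¬b b∧¬a : V → Bool
    a∨b x = a x ∨ b x
    a∧b x = a x ∧ b x
    a∧¬b x = a x ∧ not (b x)
    b∧¬a x = b x ∧ not (a x)

    uβ : Unique β
    uβ = Unique-resp-↭ α↭β uα

    -- Both sides equal γ - (A ∪ B): from α delete A first, from β delete B first.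
    common : α ∖ a∨b ≡ β ∖ a∨b
    common = begin
      α ∖ a∨b       ≡⟨ ∖-∖ a b a∨b α (λ x → ¬a∧¬b (a x) (b x)) ⟨
      α ∖ a ∖ b     ≡⟨ cong (_∖ b) α∖a ⟩
      γ ∖ a ∖ b     ≡⟨ ∖-∖ a b a∨b γ (λ x → ¬a∧¬b (a x) (b x)) ⟩
      γ ∖ a∨b       ≡⟨ ∖-∖ b a a∨b γ (λ x → ¬b∧¬a (a x) (b x)) ⟨
      γ ∖ b ∖ a     ≡⟨ cong (_∖ a) β∖b ⟨
      β ∖ b ∖ a     ≡⟨ ∖-∖ b a a∨b β (λ x → ¬b∧¬a (a x) (b x)) ⟩
      β ∖ a∨b       ∎
      where
      open ≡-Reasoning
      ¬a∧¬b : ∀ p q → not p ∧ not q ≡ not (p ∨ q)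
      ¬a∧¬b true q = refl
      ¬a∧¬b false q = refl
      ¬b∧¬a : ∀ p q → not q ∧ not p ≡ not (p ∨ q)
      ¬b∧¬a p q = trans (∧-comm (not q) (not p)) (¬a∧¬b p q)

    length-a∨b : length (filterᵇ a∨b α) ≡
      length (filterᵇ a∧b α) + length (filterᵇ a∧¬b α) + length (filterᵇ b∧¬a α)
    length-a∨b = begin
      length (filterᵇ a∨b α)
        ≡⟨ length-filterᵇ-split a∨b a α ⟩
      length (filterᵇ (λ x → a∨b x ∧ a x) α) + length (filterᵇ (λ x → a∨b x ∧ not (a x)) α)
        ≡⟨ cong₂ (λ u v → length u + length v) (filterᵇ-cong α (λ {x} _ → absorb (a x) (b x)))
             (filterᵇ-cong α (λ {x} _ → rest (a x) (b x))) ⟩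
      length (filterᵇ a α) + length (filterᵇ b∧¬a α)
        ≡⟨ cong (_+ length (filterᵇ b∧¬a α)) (length-filterᵇ-split a b α) ⟩
      length (filterᵇ a∧b α) + length (filterᵇ a∧¬b α) + length (filterᵇ b∧¬a α) ∎
      where
      open ≡-Reasoning
      absorb : ∀ p q → (p ∨ q) ∧ p ≡ p
      absorb true q = refl
      absorb false true = refl
      absorb false false = refl
      rest : ∀ p q → (p ∨ q) ∧ not p ≡ q ∧ not p
      rest true true = refl
      rest true false = refl
      rest false q = refl

    length-filterᵇ-∖ : (f g h : V → Bool) → (∀ x → not (g x) ∧ f x ≡ h x) →
      length (filterᵇ f (γ ∖ g)) ≡ length (filterᵇ h α)
    length-filterᵇ-∖ f g h eq = trans
      (cong length (trans (filterᵇ-filterᵇ f (not ∘ g) γ) (filterᵇ-cong γ (λ {x} _ → eq x))))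
      (↭-length (filterᵇ-↭ h (↭-sym α↭γ)))

    module _ {us : List V} (us↭ : us ↭ filterᵇ a∨b α) where

      -- A ∩ B, A and B in the order of `us`, as `splits` lists them.
      ds as bs : List V
      ds = filterᵇ a∧b us
      as = filterᵇ a us
      bs = filterᵇ b us

      uus : Unique us
      uus = Unique-resp-↭ (↭-sym us↭) (Unique.filter⁺ _ uα)

      us-sound : ∀ {x} → x ∈ us → x ∈ α × a∨b x ≡ true
      us-sound x∈us = ∈-filterᵇ⁻ a∨b α (∈-resp-↭ us↭ x∈us)

      filterᵇ-us : (f : V → Bool) → (∀ x → a∨b x ∧ f x ≡ f x) → filterᵇ f us ↭ filterᵇ f α
      filterᵇ-us f eq = ↭-trans (filterᵇ-↭ f us↭)
        (↭-reflexive (trans (filterᵇ-filterᵇ f a∨b α) (filterᵇ-cong α (λ {x} _ → eq x))))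

      ds↭ : ds ↭ filterᵇ a∧b α
      ds↭ = filterᵇ-us a∧b (λ x → eq (a x) (b x))
        where
        eq : ∀ p q → (p ∨ q) ∧ (p ∧ q) ≡ p ∧ q
        eq true q = refl
        eq false true = refl
        eq false false = refl

      as↭ : as ↭ filterᵇ a α
      as↭ = filterᵇ-us a (λ x → eq (a x) (b x))
        where
        eq : ∀ p q → (p ∨ q) ∧ p ≡ p
        eq true q = refl
        eq false true = refl
        eq false false = refl

      bs↭ : bs ↭ filterᵇ b α
      bs↭ = filterᵇ-us b (λ x → eq (a x) (b x))
        where
        eq : ∀ p q → (p ∨ q) ∧ q ≡ q
        eq true q = refl
        eq false true = refl
        eq false false = refl

      γ∖ds : γ ∖ mem ds ≡ γ ∖ a∧b
      γ∖ds = filterᵇ-cong γ (λ x∈γ → cong not (mem-↭filterᵇ ds↭ (∈-resp-↭ (↭-sym α↭γ) x∈γ)))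

      -- As A ∩ B is contained in A, the string α - A = γ - A also arises by deleting A from γ - (A
      -- ∩ B), the string that the merge has to produce.
      α∖as : α ∖ mem as ≡ γ ∖ a∧b ∖ a
      α∖as = trans (filterᵇ-cong α (λ x∈α → cong not (mem-↭filterᵇ as↭ x∈α)))
        (trans α∖a (sym (∖-∖ a∧b a a γ (λ x → eq (a x) (b x)))))
        where
        eq : ∀ p q → not (p ∧ q) ∧ not p ≡ not p
        eq true true = refl
        eq true false = refl
        eq false q = refl

      β∖bs : β ∖ mem bs ≡ γ ∖ a∧b ∖ b
      β∖bs = trans (filterᵇ-cong β (λ x∈β → cong not (mem-↭filterᵇ bs↭ (∈-resp-↭ (↭-sym α↭β) x∈β))))
        (trans β∖b (sym (∖-∖ a∧b b b γ (λ x → eq (a x) (b x)))))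
        where
        eq : ∀ p q → not (p ∧ q) ∧ not q ≡ not q
        eq true q = ∧-idem (not q)
        eq false q = refl

      ∈-splits : ∀ {e} → length (filterᵇ a∧¬b α) + length (filterᵇ b∧¬a α) ≡ e →
        (ds , as , bs) ∈ splits us (length (filterᵇ a∧b α)) e
      ∈-splits refl = splits-complete us _ _ a b (proj₂ ∘ us-sound) (↭-length ds↭)
        (cong₂ _+_ (↭-length (filterᵇ-us a∧¬b (λ x → eq (a x) (b x)))) (↭-length (filterᵇ-us b∧¬a (λ x → eq′ (a x) (b x)))))
        where
        eq : ∀ p q → (p ∨ q) ∧ (p ∧ not q) ≡ p ∧ not q
        eq true q = refl
        eq false true = refl
        eq false false = refl
        eq′ : ∀ p q → (p ∨ q) ∧ (q ∧ not p) ≡ q ∧ not p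
        eq′ true q = refl
        eq′ false true = refl
        eq′ false false = refl

      -- Inside γ - (A ∩ B) the sets A and B are disjoint and have become A - B and B - A.
      ∈-merges : ∀ {e} → length (filterᵇ a∧¬b α) + length (filterᵇ b∧¬a α) ≡ e →
        γ ∖ mem ds ∈ merges (α ∖ mem as) (β ∖ mem bs) e
      ∈-merges {e} refl = subst (_∈ merges (α ∖ mem as) (β ∖ mem bs) e) (sym γ∖ds)
        (merges-complete (γ ∖ a∧b) a b e
          (λ x∈ → not-injective (proj₂ (∈-filterᵇ⁻ (not ∘ a∧b) γ x∈)))
          (≤-reflexive (cong₂ _+_ (length-filterᵇ-∖ a a∧b a∧¬b (λ x → eq (a x) (b x)))
            (length-filterᵇ-∖ b a∧b b∧¬a (λ x → eq′ (a x) (b x)))))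
          α∖as β∖bs)
        where
        eq : ∀ p q → not (p ∧ q) ∧ p ≡ p ∧ not q
        eq true true = refl
        eq true false = refl
        eq false q = refl
        eq′ : ∀ p q → not (p ∧ q) ∧ q ≡ q ∧ not p
        eq′ true true = refl
        eq′ true false = refl
        eq′ false q = sym (∧-comm q true)

      ∈-insertAll : γ ∈ insertAll (length α) (length (filterᵇ a∧b α)) ds (γ ∖ mem ds)
      ∈-insertAll = insertAll-complete (length α) _ ds γ (↭-length ds↭) (Unique.filter⁺ _ uus)
        (λ x∈ds → ∈-resp-↭ α↭γ (proj₁ (us-sound (proj₁ (∈-filterᵇ⁻ a∧b us x∈ds)))))
        (Unique-resp-↭ α↭γ uα) (sym (↭-length α↭γ))

    ∈-candidatesAt : ∀ {r d} → length (α ∖ a∨b) ≡ r → length (filterᵇ a∧b α) ≡ d →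
      length (filterᵇ b∧¬a α) ≡ length (filterᵇ a∧¬b α) → γ ∈ candidatesAt α β r d (length (filterᵇ a∧¬b α))
    ∈-candidatesAt refl refl t≡
      with us , us∈ , us↭ ← covers-complete α β _ _ a∨b uα uβ α↭β common refl (trans length-a∨b (cong (length (filterᵇ a∧b α) + length (filterᵇ a∧¬b α) +_) t≡))
      = ∈-concatMap us∈ (∈-concatMap (∈-splits us↭ (cong (length (filterᵇ a∧¬b α) +_) t≡))
          (∈-concatMap (∈-merges us↭ (cong (length (filterᵇ a∧¬b α) +_) t≡)) (∈-insertAll us↭)))

    ∈-candidates : ∀ {k} → length (filterᵇ a α) ≡ k → length (filterᵇ b α) ≡ k → γ ∈ candidates α β k
    ∈-candidates {k} ∣a∣≡k ∣b∣≡k = ∈-concatMap (∈-upTo⁺ (s≤s (⊓-glb t≤k t≤n∸k)))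
      (∈-candidatesAt r≡ (sym k∸t≡d) t′≡t)
      where
      d = length (filterᵇ a∧b α)
      t = length (filterᵇ a∧¬b α)
      t′ = length (filterᵇ b∧¬a α)
      r = length (α ∖ a∨b)
      d+t≡k : d + t ≡ k
      d+t≡k = trans (sym (length-filterᵇ-split a b α)) ∣a∣≡k
      d+t′≡k : d + t′ ≡ k
      d+t′≡k = trans (cong (λ xs → length xs + t′) (filterᵇ-cong α (λ {x} _ → ∧-comm (a x) (b x))))
        (trans (sym (length-filterᵇ-split b a α)) ∣b∣≡k)
      -- Since A and B both have k symbols, A - B and B - A have equal size, and one parameter t
      -- serves for both.
      t′≡t : t′ ≡ t
      t′≡t = +-cancelˡ-≡ d t′ t (trans d+t′≡k (sym d+t≡k))
      k+t+r≡n : k + t + r ≡ length α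
      k+t+r≡n = trans (cong (_+ r) (trans (cong₂ _+_ (sym d+t≡k) (sym t′≡t)) (sym length-a∨b))) (length-∖ a∨b α)
      r≡ : r ≡ length α ∸ (k + t)
      r≡ = sym (trans (cong (_∸ (k + t)) (sym k+t+r≡n)) (m+n∸m≡n (k + t) r))
      k∸t≡d : k ∸ t ≡ d
      k∸t≡d = trans (cong (_∸ t) (sym d+t≡k)) (m+n∸n≡m d t)
      t≤k : t ≤ k
      t≤k = subst (t ≤_) d+t≡k (m≤n+m t d)
      t≤n∸k : t ≤ length α ∸ k
      t≤n∸k = subst (t ≤_) (trans (sym (m+n∸m≡n k (t + r))) (cong (_∸ k) (trans (sym (+-assoc k t r)) k+t+r≡n))) (m≤m+n t r)

-- Permutations of Fin n

delete≡∖ : ∀ {n} (A : Subset n) xs → delete A xs ≡ xs ∖ lookup A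
delete≡∖ A [] = refl
delete≡∖ A (x ∷ xs) with lookup A x
... | true  = delete≡∖ A xs
... | false = cong (x ∷_) (delete≡∖ A xs)

allFin-↭ : ∀ {n} {σ : List (Fin n)} → IsPerm σ → allFin n ↭ σ
allFin-↭ (len , u) = unique-⊆⇒↭ u (λ {x} _ → ∈-allFin x) (trans len (sym (length-tabulate (λ i → i))))

perms-↭ : ∀ {n} {σ τ : List (Fin n)} → IsPerm σ → IsPerm τ → σ ↭ τ
perms-↭ pσ pτ = ↭-trans (↭-sym (allFin-↭ pσ)) (allFin-↭ pτ)

length-filterᵇ-tabulate : ∀ {n} {V : Set} (A : Subset n) (f : V → Bool) (g : Fin n → V) →
  (∀ i → f (g i) ≡ lookup A i) → length (filterᵇ f (tabulate g)) ≡ ∣ A ∣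
length-filterᵇ-tabulate [] f g eq = refl
length-filterᵇ-tabulate (s ∷ A) f g eq with f (g zero) | s | eq zero
... | true  | true  | _ = cong suc (length-filterᵇ-tabulate A f (g ∘ suc) (eq ∘ suc))
... | false | false | _ = length-filterᵇ-tabulate A f (g ∘ suc) (eq ∘ suc)

length-filterᵇ-lookup : ∀ {n} {σ : List (Fin n)} (A : Subset n) → IsPerm σ → length (filterᵇ (lookup A) σ) ≡ ∣ A ∣
length-filterᵇ-lookup A pσ = trans (↭-length (filterᵇ-↭ (lookup A) (↭-sym (allFin-↭ pσ))))
  (length-filterᵇ-tabulate A (lookup A) (λ i → i) (λ _ → refl))

-- The last equation is the inclusion of A in A′, in the form that successive deletion uses. Padding
-- gives every deletion set exactly k symbols.
enlarge : ∀ {n} (A : Subset n) k → ∣ A ∣ ≤ k → k ≤ n →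
  ∃[ A′ ] (∣ A′ ∣ ≡ k × (∀ i → not (lookup A i) ∧ not (lookup A′ i) ≡ not (lookup A′ i)))
enlarge [] zero _ _ = [] , refl , λ ()
enlarge (true ∷ A) (suc k) (s≤s ∣A∣≤k) (s≤s k≤n) with A′ , ∣A′∣≡k , A⊆A′ ← enlarge A k ∣A∣≤k k≤n =
  true ∷ A′ , cong suc ∣A′∣≡k , λ { zero → refl ; (suc i) → A⊆A′ i }
enlarge {suc n} (false ∷ A) k ∣A∣≤k k≤1+n with k ≤? n
-- The first symbol stays out as long as k fits into the tail; otherwise k is the full size and
-- every symbol is taken.
... | yes k≤n with A′ , ∣A′∣≡k , A⊆A′ ← enlarge A k ∣A∣≤k k≤n =
  false ∷ A′ , ∣A′∣≡k , λ { zero → refl ; (suc i) → A⊆A′ i }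
... | no k≰n with refl ← ≤-antisym k≤1+n (≰⇒> k≰n) with A′ , ∣A′∣≡n , A⊆A′ ← enlarge A n (∣p∣≤n A) ≤-refl =
  true ∷ A′ , cong suc ∣A′∣≡n , λ { zero → refl ; (suc i) → A⊆A′ i }

-- Deleting further symbols from equal strings leaves them equal, so a witness for distance at most
-- k extends to one of size k.
deletion-of-size : ∀ {n} {σ τ : List (Fin n)} {k} → IsPerm σ → k ≤ n → UlamDist≤ σ τ k →
  ∃[ f ] (length (filterᵇ f σ) ≡ k × σ ∖ f ≡ τ ∖ f)
deletion-of-size {σ = σ} {τ} {k} pσ k≤n (_ , ((A , refl , eq) , _) , ∣A∣≤k)
  with A′ , ∣A′∣≡k , A⊆A′ ← enlarge A k ∣A∣≤k k≤n =
  lookup A′ , trans (length-filterᵇ-lookup A′ pσ) ∣A′∣≡k ,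
  trans (sym (absorb σ)) (trans (cong (_∖ lookup A′) σ∖A) (absorb τ))
  where
  σ∖A : σ ∖ lookup A ≡ τ ∖ lookup A
  σ∖A = trans (sym (delete≡∖ A σ)) (trans eq (delete≡∖ A τ))
  absorb : ∀ xs → xs ∖ lookup A ∖ lookup A′ ≡ xs ∖ lookup A′
  absorb xs = ∖-∖ (lookup A) (lookup A′) (lookup A′) xs A⊆A′

-- The symbols outside a common subsequence `ws` form a deletion set of size n - |ws|, and
-- minimality of k makes this at least k.
commonBound : ∀ {n} {α β : List (Fin n)} {k} → IsPerm α → IsPerm β → UlamDist α β k →
  Enumeration.CommonBound _≟_ α β (n ∸ k)
commonBound {n} {α} {β} {k} pα pβ (_ , minimal) {ws} ws⊆α ws⊆β = m+n≤o⇒m≤o∸n (length ws) (begin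
  length ws + k                                        ≡⟨ +-comm (length ws) k ⟩
  k + length ws                                        ≤⟨ +-monoˡ-≤ (length ws) (minimal ws∁ (trans (delete-ws∁ pα ws⊆α) (sym (delete-ws∁ pβ ws⊆β)))) ⟩
  ∣ ws∁ ∣ + length ws                                    ≡⟨ cong₂ _+_ (length-filterᵇ-lookup ws∁ pα) (cong length (trans (sym (delete≡∖ ws∁ α)) (delete-ws∁ pα ws⊆α))) ⟨
  length (filterᵇ (lookup ws∁) α) + length (α ∖ lookup ws∁) ≡⟨ length-∖ (lookup ws∁) α ⟩
  length α                                             ≡⟨ proj₁ pα ⟩
  n                                                    ∎)
  where
  open ≤-Reasoning
  open Enumeration (_≟_ {n})
  ws∁ : Subset n
  ws∁ = Vec.tabulate (not ∘ mem ws)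
  delete-ws∁ : ∀ {σ} → IsPerm σ → ws ⊆ σ → delete ws∁ σ ≡ ws
  delete-ws∁ {σ} (_ , uσ) ws⊆σ = trans (delete≡∖ ws∁ σ) (trans
    (filterᵇ-cong σ (λ {x} _ → trans (cong not (lookup∘tabulate (not ∘ mem ws) x)) (not-involutive (mem ws x))))
    (filterᵇ-mem-⊆ ws⊆σ uσ))

-- The real exponent C k^(2/3) is replaced by a natural number m with m³ ≤ C³ k², the division by (n
-- - k)! is cleared, and the cardinality is bounded through all duplicate-free lists of members.
theorem4 : ∃[ C ] ((n k : ℕ) → 1 ≤ n → (α β : List (Fin n)) → IsPerm α → IsPerm β
    → UlamDist α β k
    → ∃[ m ] ((m ^ 3 ≤ (C ^ 3) * (k ^ 2))
    × ((γs : List (List (Fin n))) → Unique γs → All (InBall2 α β k) γs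
    → length γs * ((n ∸ k) !) ≤ (2 ^ (k + m)) * (n !))))
-- The exponent is m = 9p with p³ ≤ 8 · 128 k² = 1024 k². As 11³ = 1331 exceeds 1024, C = 9 · 11
-- suffices.
theorem4 = 99 , λ n k _ α β pα pβ dist →
  let p , 128k²≤p³ , p³≤8*128k² = cube-root (128 * (k * k)) in
  9 * p , size k p p³≤8*128k² , count n k α β pα pβ dist p 128k²≤p³
  where
  size : ∀ k p → p ^ 3 ≤ 8 * (128 * (k * k)) → (9 * p) ^ 3 ≤ 99 ^ 3 * k ^ 2
  size k p p³≤ = begin
    (9 * p) ^ 3                  ≡⟨ ^-distribʳ-* 3 9 p ⟩
    729 * p ^ 3                  ≤⟨ *-monoʳ-≤ 729 p³≤ ⟩
    729 * (8 * (128 * (k * k)))  ≡⟨ trans (cong (729 *_) (sym (*-assoc 8 128 (k * k)))) (sym (*-assoc 729 1024 (k * k))) ⟩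
    729 * 1024 * (k * k)         ≤⟨ *-monoˡ-≤ (k * k) (≤ᵇ⇒≤ (729 * 1024) (99 ^ 3) tt) ⟩
    99 ^ 3 * (k * k)             ≡⟨ cong (λ x → 99 ^ 3 * (k * x)) (*-identityʳ k) ⟨
    99 ^ 3 * k ^ 2               ∎
    where open ≤-Reasoning
  count : ∀ n k (α β : List (Fin n)) → IsPerm α → IsPerm β → UlamDist α β k → ∀ p → 128 * (k * k) ≤ p ^ 3 →
    (γs : List (List (Fin n))) → Unique γs → All (InBall2 α β k) γs →
    length γs * (n ∸ k) ! ≤ 2 ^ (k + 9 * p) * n !
  count n k α β pα@(∣α∣≡n , uα) pβ dist@((A , ∣A∣≡k , _) , _) p k≤p γs uγs inBalls = ≤-trans
    (*-monoˡ-≤ ((n ∸ k) !) (unique-⊆⇒length≤ uγs (listed ∘ All.lookup inBalls)))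
    (length-candidates α β k p ∣α∣≡n k≤n (commonBound pα pβ dist) k≤p)
    where
    open Enumeration (_≟_ {n})
    k≤n : k ≤ n
    k≤n = subst (_≤ n) ∣A∣≡k (∣p∣≤n A)
    listed : ∀ {γ} → InBall2 α β k γ → γ ∈ candidates α β k
    listed {γ} (pγ , α-γ , β-γ)
      with a , ∣a∣≡k , α∖a ← deletion-of-size {τ = γ} pα k≤n α-γ | b , ∣b∣≡k , β∖b ← deletion-of-size {τ = γ} pβ k≤n β-γ =
      ∈-candidates α β γ a b uα (perms-↭ pα pβ) (perms-↭ pα pγ) α∖a β∖b ∣a∣≡k
        (trans (↭-length (filterᵇ-↭ b (perms-↭ pα pβ))) ∣b∣≡k)
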